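{- Let $\pi\in\mathfrak{B}_n$, write $d=\operatorname{des}_B(\pi)$, $e=\operatorname{ides}_B(\pi)$, and let $n(\pi)$ be the number of negative entries among $\pi_1,\dots,\pi_n$. Among the grid points $(i,j)$, $1\le i,j\le n+1$, of $P_\pi$, with $d$-types taken with respect to the $r$-order, the number with $d^+$-type $(0,0)$, $(1,0)$, $(0,1)$, $(1,1)$ is respectively $(d+1)(e+1)-n(\pi)+n$, $(e+1)(n-d)+n(\pi)-n$, $(d+1)(n-e)+n(\pi)-n$, $(n-d)(n-e)-n(\pi)+n$; and the number with $d^-$-type $(0,0)$, $(1,0)$, $(0,1)$, $(1,1)$ is respectively $de+n(\pi)$, $e(n-d+1)-n(\pi)$, $d(n-e+1)-n(\pi)$, $(n-d+1)(n-e+1)+n(\pi)$.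
   Context: $\mathfrak{B}_n$ is the set of signed permutations $\pi=\pi_1\cdots\pi_n$ ($\pi_i\in\{\pm1,\dots,\pm n\}$, $|\pi_1|,\dots,|\pi_n|$ a permutation of $[n]$), $\pi_0=0$, inverse given by $\pi^{ -1}_{|\pi_i|}=\operatorname{sgn}(\pi_i)\,i$. The $r$-order on $\mathbb{Z}$ is $-1<_r-2<_r-3<_r\cdots<_r0<_r1<_r2<_r\cdots$; $\operatorname{des}_B(\pi)=|\{i\in\{0,\dots,n-1\}:\pi_i>_r\pi_{i+1}\}|$, $\operatorname{ides}_B(\pi)=\operatorname{des}_B(\pi^{ -1})$. Grid points $(i,j)$, $1\le i,j\le n+1$, of the $n\times n$ grid $P_\pi$ are intersections of the $i$-th horizontal (from top) and $j$-th vertical (from left) grid lines. For $i,j\in[n+1]$, $\varphi_{(i,j)}(\pi)$ is the $\sigma\in\mathfrak{B}_{n+1}$ with $\sigma_i=j$, $\sigma_k=s(\pi_k)$ for $k<i$, $\sigma_k=s(\pi_{k-1})$ for $k>i$, where $s(x)=x$ if $|x|<j$, $s(x)=x+1$ if $x\ge j$, $s(x)=x-1$ if $x\le-j$; $\overline{\varphi}_{(i,j)}(\pi)$ is the same with $\sigma_i=-j$. $d^+(i,j)=\big(\operatorname{des}_B(\varphi_{(i,j)}(\pi))-\operatorname{des}_B(\pi),\ \operatorname{ides}_B(\varphi_{(i,j)}(\pi))-\operatorname{ides}_B(\pi)\big)$, and $d^-(i,j)$ is the same with $\overline{\varphi}_{(i,j)}$. -}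

module Defs where

open import Data.Bool using (Bool; true; false; if_then_else_)
open import Data.Nat as ℕ using (ℕ; zero; suc; _∸_)
open import Data.Integer as ℤ using (ℤ; +_; -[1+_]; ∣_∣)
open import Data.List using (List; []; _∷_; map; length; take; drop; _++_; upTo; concatMap)
open import Data.List.Relation.Binary.Permutation.Propositional using (_↭_)
open import Data.Product using (_×_; _,_)
open import Relation.Nullary.Decidable using (⌊_⌋)

range1 : ℕ → List ℕ
range1 n = map suc (upTo n)

IsSignedPerm : ℕ → List ℤ → Set
IsSignedPerm n π = map ∣_∣ π ↭ range1 n

isNeg : ℤ → Bool
isNeg (+ _)    = false
isNeg -[1+ _ ] = true

-- the r-order: -1 <r -2 <r -3 <r ⋯ <r 0 <r 1 <r 2 <r ⋯   (x <r y as a Boolean)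
_<r_ : ℤ → ℤ → Bool
-[1+ a ] <r -[1+ b ] = ⌊ a ℕ.<? b ⌋
-[1+ _ ] <r (+ _)    = true
(+ _)    <r -[1+ _ ] = false
(+ a)    <r (+ b)    = ⌊ a ℕ.<? b ⌋

descents : List ℤ → ℕ
descents (x ∷ y ∷ r) = (if y <r x then 1 else 0) ℕ.+ descents (y ∷ r)
descents _ = 0

-- des_B(π) = #{ i ∈ {0,…,n-1} : πᵢ >r πᵢ₊₁ } with π₀ = 0
desB : List ℤ → ℕ
desB π = descents (+ 0 ∷ π)

sgnMul : ℤ → ℕ → ℤ
sgnMul (+ _)    i = + i
sgnMul -[1+ _ ] i = ℤ.- (+ i)

findPos : ℕ → ℕ → List ℤ → ℤ
findPos i k [] = + 0
findPos i k (x ∷ xs) = if ⌊ ∣ x ∣ ℕ.≟ k ⌋ then sgnMul x i else findPos (suc i) k xs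

-- inverse: π⁻¹_{|πᵢ|} = sgn(πᵢ) i
invB : List ℤ → List ℤ
invB π = map (λ k → findPos 1 k π) (range1 (length π))

idesB : List ℤ → ℕ
idesB π = desB (invB π)

negCount : List ℤ → ℕ
negCount [] = 0
negCount (x ∷ xs) = (if isNeg x then 1 else 0) ℕ.+ negCount xs

shift : ℕ → ℤ → ℤ
shift j x = if ⌊ ∣ x ∣ ℕ.<? j ⌋ then x
            else (if isNeg x then x ℤ.- ℤ.1ℤ else x ℤ.+ ℤ.1ℤ)

insertAt : ℕ → ℤ → List ℤ → List ℤ
insertAt i v xs = take (i ∸ 1) xs ++ (v ∷ drop (i ∸ 1) xs)

φ : ℕ → ℕ → List ℤ → List ℤ
φ i j π = insertAt i (+ j) (map (shift j) π)

φbar : ℕ → ℕ → List ℤ → List ℤ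
φbar i j π = insertAt i (ℤ.- (+ j)) (map (shift j) π)

dtype : List ℤ → List ℤ → ℤ × ℤ
dtype σ π = ((+ desB σ) ℤ.- (+ desB π)) , ((+ idesB σ) ℤ.- (+ idesB π))

dplus : ℕ → ℕ → List ℤ → ℤ × ℤ
dplus i j π = dtype (φ i j π) π

dminus : ℕ → ℕ → List ℤ → ℤ × ℤ
dminus i j π = dtype (φbar i j π) π

gridPoints : ℕ → List (ℕ × ℕ)
gridPoints n = concatMap (λ i → map (λ j → (i , j)) (range1 (suc n))) (range1 (suc n))

sameType : ℤ × ℤ → ℤ × ℤ → Bool
sameType (a , b) (c , d) = if ⌊ a ℤ.≟ c ⌋ then ⌊ b ℤ.≟ d ⌋ else false

countWhere : {A : Set} → (A → Bool) → List A → ℕ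
countWhere p [] = 0
countWhere p (x ∷ xs) = (if p x then 1 else 0) ℕ.+ countWhere p xs

countPlus : ℕ → List ℤ → ℤ × ℤ → ℕ
countPlus n π t = countWhere (λ { (i , j) → sameType (dplus i j π) t }) (gridPoints n)

countMinus : ℕ → List ℤ → ℤ × ℤ → ℕ
countMinus n π t = countWhere (λ { (i , j) → sameType (dminus i j π) t }) (gridPoints n)

{-# OPTIONS --safe #-}
module Submission where

-- Inserting ±j in row i raises des_B by 1 − g(i,j), where g(i,j) is the descent indicator of π at
-- gap i plus the increment from position i − 1 to position i of P(·,j), P(k,j) telling whether the
-- shifted π_k exceeds ±j (with π_0 = 0 and π_{n+1} = +∞). The inverse of an insertion at (i,j) is
-- the insertion at (j,i) into the inverse, so ides_B is governed by the same expression h for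
-- π⁻¹. Both g and h are 0 or 1, so the four counts follow from Σ g, Σ h and Σ g h. The first two
-- telescope; in the third, summation by parts over j of the product of the two increments leaves
-- one term for each entry of π that has the sign of the insertion.

open import Defs
open import Data.Nat using (ℕ)
open import Data.Integer using (ℤ; +_; _+_; _-_; _*_; 0ℤ; 1ℤ)
open import Data.List using (List)
open import Data.Product using (_×_; _,_)
open import Relation.Binary.PropositionalEquality using (_≡_)

open import Data.Bool using (Bool; true; false; not; if_then_else_)
open import Data.Fin using (toℕ)
open import Data.Fin.Properties using (toℕ<n)
open import Data.Integer using (-[1+_]; ∣_∣; -_; _◃_)
open import Data.Integer.Properties using (+-*-semiring; *-zeroˡ; *-zeroʳ; *-identityʳ)
open import Data.Integer.Tactic.RingSolver using (solve-∀)
open import Data.List using ([]; _∷_; _++_; map; length; take; drop; head; upTo; applyUpTo; concatMap)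
open import Data.List.Properties using (map-∘; map-cong; map-upTo; length-map; length-upTo)
open import Data.List.Relation.Binary.Permutation.Propositional using (↭-sym; ↭⇒↭ₛ)
open import Data.List.Relation.Binary.Permutation.Propositional.Properties using (All-resp-↭; ↭-length)
open import Data.List.Relation.Binary.Permutation.Setoid.Properties using (Unique-resp-↭)
open import Data.List.Relation.Unary.All using (All; []; _∷_)
import Data.List.Relation.Unary.All.Properties as All
open import Data.List.Relation.Unary.AllPairs using ([]; _∷_)
open import Data.List.Relation.Unary.Unique.Propositional using (Unique)
import Data.List.Relation.Unary.Unique.Propositional.Properties as Unique
open import Data.Maybe using (Maybe; just; nothing; maybe)
open import Data.Nat using (zero; suc; _≤_; _<_; z≤n; s≤s; s≤s⁻¹; _<ᵇ_; _≡ᵇ_; _<?_; _≟_)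
import Data.Nat as ℕ
import Data.Nat.Properties as ℕ
open import Data.Product using (proj₁; proj₂)
open import Data.Sign using (Sign)
open import Data.Sum using (_⊎_; inj₁; inj₂)
open import Function using (_∘_)
open import Relation.Nullary using (contradiction; yes; no)
open import Relation.Nullary.Decidable using (⌊_⌋; isYes≗does)
open import Relation.Binary.PropositionalEquality
  using (refl; sym; trans; cong; cong₂; subst; setoid; module ≡-Reasoning)
import Algebra.Properties.Semiring.Sum +-*-semiring as Sum

-- The literal `if` under `+_` makes `ι b` agree by computation with the summands of `descents` and
-- `countWhere`.
ι : Bool → ℤ
ι b = + (if b then 1 else 0)

-- Finite sums

-- Summands are indexed by `ℕ`, so that neighbouring terms such as `f (suc k)` can be formed, while
-- the library sum over `Fin` supplies exchange and distributivity.
Σ< : ℕ → (ℕ → ℤ) → ℤ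
Σ< n f = Sum.sum {n} (f ∘ toℕ)

Σ<² : ℕ → (ℕ → ℕ → ℤ) → ℤ
Σ<² n f = Σ< n (λ i → Σ< n (f i))

Σ<-cong : ∀ n {f g : ℕ → ℤ} → (∀ {k} → k < n → f k ≡ g k) → Σ< n f ≡ Σ< n g
Σ<-cong n eq = Sum.sum-cong-≗ {n} (λ k → eq (toℕ<n k))

Σ<²-cong : ∀ n {f g : ℕ → ℕ → ℤ} → (∀ {i j} → i < n → j < n → f i j ≡ g i j) →
           Σ<² n f ≡ Σ<² n g
Σ<²-cong n eq = Σ<-cong n (λ i<n → Σ<-cong n (eq i<n))

Σ<-distrib-+ : ∀ n (f g : ℕ → ℤ) → Σ< n (λ k → f k + g k) ≡ Σ< n f + Σ< n g
Σ<-distrib-+ n f g = Sum.∑-distrib-+ {n} (f ∘ toℕ) (g ∘ toℕ)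

Σ<-*ˡ : ∀ n c (f : ℕ → ℤ) → Σ< n (λ k → c * f k) ≡ c * Σ< n f
Σ<-*ˡ n c f = sym (Sum.*-distribˡ-sum {n} c (f ∘ toℕ))

Σ<-*ʳ : ∀ n c (f : ℕ → ℤ) → Σ< n (λ k → f k * c) ≡ Σ< n f * c
Σ<-*ʳ n c f = sym (Sum.*-distribʳ-sum {n} c (f ∘ toℕ))

Σ<²-comm : ∀ n (f : ℕ → ℕ → ℤ) → Σ<² n f ≡ Σ<² n (λ j i → f i j)
Σ<²-comm n f = Sum.∑-comm {n} {n} (λ i j → f (toℕ i) (toℕ j))

Σ<²-distrib-+ : ∀ n (f g : ℕ → ℕ → ℤ) →
                Σ<² n (λ i j → f i j + g i j) ≡ Σ<² n f + Σ<² n g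
Σ<²-distrib-+ n f g =
  trans (Σ<-cong n (λ {i} _ → Σ<-distrib-+ n (f i) (g i)))
        (Σ<-distrib-+ n (λ i → Σ< n (f i)) (λ i → Σ< n (g i)))

Σ<-neg : ∀ n (f : ℕ → ℤ) → Σ< n (λ k → - f k) ≡ - Σ< n f
Σ<-neg zero    f = refl
Σ<-neg (suc n) f = trans (cong (_+_ (- f 0)) (Σ<-neg n (f ∘ suc))) (lemma (f 0) (Σ< n (f ∘ suc)))
  where
  lemma : ∀ a b → - a + - b ≡ - (a + b)
  lemma = solve-∀

Σ<-distrib-- : ∀ n (f g : ℕ → ℤ) → Σ< n (λ k → f k - g k) ≡ Σ< n f - Σ< n g
Σ<-distrib-- n f g = trans (Σ<-distrib-+ n f (-_ ∘ g)) (cong (_+_ (Σ< n f)) (Σ<-neg n g))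

Σ<²-distrib-- : ∀ n (f g : ℕ → ℕ → ℤ) →
                Σ<² n (λ i j → f i j - g i j) ≡ Σ<² n f - Σ<² n g
Σ<²-distrib-- n f g =
  trans (Σ<-cong n (λ {i} _ → Σ<-distrib-- n (f i) (g i)))
        (Σ<-distrib-- n (λ i → Σ< n (f i)) (λ i → Σ< n (g i)))

Σ<-const : ∀ n c → Σ< n (λ _ → c) ≡ + n * c
Σ<-const zero    c = sym (*-zeroˡ c)
Σ<-const (suc n) c = trans (cong (_+_ c) (Σ<-const n c)) (lemma (+ n) c)
  where
  lemma : ∀ m c → c + m * c ≡ (1ℤ + m) * c
  lemma = solve-∀

Σ<-telescope : ∀ n (f : ℕ → ℤ) → Σ< n (λ k → f (suc k) - f k) ≡ f n - f 0
Σ<-telescope zero    f = lemma (f 0)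
  where
  lemma : ∀ a → 0ℤ ≡ a - a
  lemma = solve-∀
Σ<-telescope (suc n) f =
  trans (cong (_+_ (f 1 - f 0)) (Σ<-telescope n (f ∘ suc))) (lemma (f 0) (f 1) (f (suc n)))
  where
  lemma : ∀ a b c → (b - a) + (c - b) ≡ c - a
  lemma = solve-∀

Σ<-telescope′ : ∀ n (f : ℕ → ℤ) → Σ< n (λ k → f k - f (suc k)) ≡ f 0 - f n
Σ<-telescope′ n f = begin
  Σ< n (λ k → f k - f (suc k))      ≡⟨ Σ<-cong n (λ {k} _ → flip-- (f k) (f (suc k))) ⟩
  Σ< n (λ k → - (f (suc k) - f k))  ≡⟨ Σ<-neg n (λ k → f (suc k) - f k) ⟩
  - Σ< n (λ k → f (suc k) - f k)    ≡⟨ cong -_ (Σ<-telescope n f) ⟩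
  - (f n - f 0)                     ≡⟨ flip-- (f 0) (f n) ⟨
  f 0 - f n                         ∎
  where
  open ≡-Reasoning
  flip-- : ∀ a b → a - b ≡ - (b - a)
  flip-- = solve-∀

-- Abel summation, moving the difference from `g` to `f`. The two boundary products will later carry
-- the values at the leading 0 and at the terminal +∞.
Σ<-by-parts : ∀ n (f g : ℕ → ℤ) →
              Σ< (suc n) (λ k → f k * (g (suc k) - g k)) ≡
              (f n * g (suc n) - f 0 * g 0) + Σ< n (λ k → (f k - f (suc k)) * g (suc k))
Σ<-by-parts zero    f g = lemma (f 0) (g 0) (g 1)
  where
  lemma : ∀ a b c → a * (c - b) + 0ℤ ≡ (a * c - a * b) + 0ℤ
  lemma = solve-∀
Σ<-by-parts (suc n) f g =
  trans (cong (_+_ (f 0 * (g 1 - g 0))) (Σ<-by-parts n (f ∘ suc) (g ∘ suc)))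
        (lemma (f 0) (f 1) (g 0) (g 1) (f (suc n) * g (suc (suc n)))
               (Σ< n (λ k → (f (suc k) - f (suc (suc k))) * g (suc (suc k)))))
  where
  lemma : ∀ a a′ b b′ z w →
          a * (b′ - b) + ((z - a′ * b′) + w) ≡ (z - a * b) + ((a - a′) * b′ + w)
  lemma = solve-∀

-- Counting grid points by double sums

countWhere-++ : ∀ {A : Set} (p : A → Bool) xs ys →
                countWhere p (xs ++ ys) ≡ countWhere p xs ℕ.+ countWhere p ys
countWhere-++ p []       ys = refl
countWhere-++ p (x ∷ xs) ys =
  trans (cong ((if p x then 1 else 0) ℕ.+_) (countWhere-++ p xs ys))
        (sym (ℕ.+-assoc (if p x then 1 else 0) _ _))

countWhere-applyUpTo : ∀ {A : Set} (p : A → Bool) (f : ℕ → A) n →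
                       + countWhere p (applyUpTo f n) ≡ Σ< n (λ k → ι (p (f k)))
countWhere-applyUpTo p f zero    = refl
countWhere-applyUpTo p f (suc n) = cong (_+_ (ι (p (f 0)))) (countWhere-applyUpTo p (f ∘ suc) n)

countWhere-concatMap : ∀ {A B : Set} (p : B → Bool) (F : A → List B) (f : ℕ → A) n →
                       + countWhere p (concatMap F (applyUpTo f n)) ≡
                       Σ< n (λ k → + countWhere p (F (f k)))
countWhere-concatMap p F f zero    = refl
countWhere-concatMap p F f (suc n) =
  trans (cong +_ (countWhere-++ p (F (f 0)) _))
        (cong (_+_ (+ countWhere p (F (f 0)))) (countWhere-concatMap p F (f ∘ suc) n))

countWhere-gridPoints : ∀ (p : ℕ × ℕ → Bool) n →
                        + countWhere p (gridPoints n) ≡ Σ<² (suc n) (λ i j → ι (p (suc i , suc j)))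
countWhere-gridPoints p n = begin
  + countWhere p (concatMap row (range1 (suc n)))
    ≡⟨ cong (λ l → + countWhere p (concatMap row l)) (map-upTo suc (suc n)) ⟩
  + countWhere p (concatMap row (applyUpTo suc (suc n)))
    ≡⟨ countWhere-concatMap p row suc (suc n) ⟩
  Σ< (suc n) (λ i → + countWhere p (row (suc i)))
    ≡⟨ Σ<-cong (suc n) (λ {i} _ → count-row i) ⟩
  Σ<² (suc n) (λ i j → ι (p (suc i , suc j)))
    ∎
  where
  open ≡-Reasoning
  row : ℕ → List (ℕ × ℕ)
  row i = map (λ j → (i , j)) (range1 (suc n))
  count-row : ∀ i → + countWhere p (row (suc i)) ≡ Σ< (suc n) (λ j → ι (p (suc i , suc j)))
  count-row i = begin
    + countWhere p (row (suc i))
      ≡⟨ cong (λ l → + countWhere p l)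
              (trans (sym (map-∘ {g = λ j → (suc i , j)} {f = suc} (upTo (suc n)))) (map-upTo (λ j → (suc i , suc j)) (suc n))) ⟩
    + countWhere p (applyUpTo (λ j → (suc i , suc j)) (suc n))
      ≡⟨ countWhere-applyUpTo p (λ j → (suc i , suc j)) (suc n) ⟩
    Σ< (suc n) (λ j → ι (p (suc i , suc j)))
      ∎

-- The shift map and the r-order

⌊<?⌋≡<ᵇ : ∀ a b → ⌊ a <? b ⌋ ≡ (a <ᵇ b)
⌊<?⌋≡<ᵇ a b = isYes≗does (a <? b)

⌊≟⌋≡≡ᵇ : ∀ a b → ⌊ a ≟ b ⌋ ≡ (a ≡ᵇ b)
⌊≟⌋≡≡ᵇ a b = isYes≗does (a ≟ b)

-- The increasing injection of `ℕ` into itself that skips exactly the value `j`.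
bump : ℕ → ℕ → ℕ
bump zero    a       = suc a
bump (suc j) zero    = zero
bump (suc j) (suc a) = suc (bump j a)

bump-≥ : ∀ {j a} → j ≤ a → bump j a ≡ suc a
bump-≥ z≤n       = refl
bump-≥ (s≤s j≤a) = cong suc (bump-≥ j≤a)

bump-< : ∀ {j a} → a < j → bump j a ≡ a
bump-< {suc j} {zero}  _         = refl
bump-< {suc j} {suc a} (s≤s a<j) = cong suc (bump-< a<j)

bump-if : ∀ j a → (if a <ᵇ j then a else suc a) ≡ bump j a
bump-if zero    a       = refl
bump-if (suc j) zero    = refl
bump-if (suc j) (suc a) with a <ᵇ j | bump-if j a
... | true  | eq = cong suc eq
... | false | eq = cong suc eq

bump-<ᵇ : ∀ j a b → (bump j a <ᵇ bump j b) ≡ (a <ᵇ b)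
bump-<ᵇ zero    a       b       = refl
bump-<ᵇ (suc j) zero    zero    = refl
bump-<ᵇ (suc j) zero    (suc b) = refl
bump-<ᵇ (suc j) (suc a) zero    = refl
bump-<ᵇ (suc j) (suc a) (suc b) = bump-<ᵇ j a b

bump-≡ᵇ : ∀ j a b → (bump j a ≡ᵇ bump j b) ≡ (a ≡ᵇ b)
bump-≡ᵇ zero    a       b       = refl
bump-≡ᵇ (suc j) zero    zero    = refl
bump-≡ᵇ (suc j) zero    (suc b) = refl
bump-≡ᵇ (suc j) (suc a) zero    = refl
bump-≡ᵇ (suc j) (suc a) (suc b) = bump-≡ᵇ j a b

bump-≢ᵇ : ∀ j a → (bump j a ≡ᵇ j) ≡ false
bump-≢ᵇ zero    a       = refl
bump-≢ᵇ (suc j) zero    = refl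
bump-≢ᵇ (suc j) (suc a) = bump-≢ᵇ j a

≢ᵇ-bump : ∀ j a → (j ≡ᵇ bump j a) ≡ false
≢ᵇ-bump zero    a       = refl
≢ᵇ-bump (suc j) zero    = refl
≢ᵇ-bump (suc j) (suc a) = ≢ᵇ-bump j a

<ᵇ-bump : ∀ j a → (j <ᵇ bump j a) ≡ (j <ᵇ suc a)
<ᵇ-bump zero    a       = refl
<ᵇ-bump (suc j) zero    = refl
<ᵇ-bump (suc j) (suc a) = <ᵇ-bump j a

bump-<ᵇ-self : ∀ j a → (bump j a <ᵇ j) ≡ not (j <ᵇ suc a)
bump-<ᵇ-self zero    a       = refl
bump-<ᵇ-self (suc j) zero    = refl
bump-<ᵇ-self (suc j) (suc a) = bump-<ᵇ-self j a

shift-+ : ∀ j a → shift (suc j) (+ a) ≡ + bump (suc j) a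
shift-+ j a rewrite ⌊<?⌋≡<ᵇ a (suc j) | sym (bump-if (suc j) a) with a <ᵇ suc j
... | true  = refl
... | false = cong +_ (ℕ.+-comm a 1)

-- The stored `a` is one less than the absolute value, so the skipped value drops from j + 1 to j.
shift-neg : ∀ j a → shift (suc j) -[1+ a ] ≡ -[1+ bump j a ]
shift-neg j a rewrite ⌊<?⌋≡<ᵇ (suc a) (suc j) | sym (bump-if j a) with a <ᵇ j
... | true  = refl
... | false = cong (λ b → -[1+ suc b ]) (ℕ.+-identityʳ a)

∣shift∣ : ∀ j x → ∣ shift (suc j) x ∣ ≡ bump (suc j) ∣ x ∣
∣shift∣ j (+ a)    = cong ∣_∣ (shift-+ j a)
∣shift∣ j -[1+ a ] = cong ∣_∣ (shift-neg j a)

shift-mono : ∀ j x y → (shift (suc j) x <r shift (suc j) y) ≡ (x <r y)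
shift-mono j (+ a) (+ b) rewrite shift-+ j a | shift-+ j b =
  trans (⌊<?⌋≡<ᵇ (bump (suc j) a) (bump (suc j) b)) (trans (bump-<ᵇ (suc j) a b) (sym (⌊<?⌋≡<ᵇ a b)))
shift-mono j (+ a) -[1+ b ] rewrite shift-+ j a | shift-neg j b = refl
shift-mono j -[1+ a ] (+ b) rewrite shift-neg j a | shift-+ j b = refl
shift-mono j -[1+ a ] -[1+ b ] rewrite shift-neg j a | shift-neg j b =
  trans (⌊<?⌋≡<ᵇ (bump j a) (bump j b)) (trans (bump-<ᵇ j a b) (sym (⌊<?⌋≡<ᵇ a b)))

-- Threshold j is the value s(j + 1), and the test on the unshifted `x` tells whether the shifted
-- one exceeds it. Among negatives the r-order grows with the absolute value, so both signs share
-- the test that j is less than the absolute value.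
above : Sign → ℕ → ℤ → Bool
above Sign.+ j (+ a)    = j <ᵇ a
above Sign.+ j -[1+ _ ] = false
above Sign.- j (+ _)    = true
above Sign.- j -[1+ a ] = j <ᵇ suc a

<r-shift : ∀ s j x → ((s ◃ suc j) <r shift (suc j) x) ≡ above s j x
<r-shift Sign.+ j (+ zero) rewrite shift-+ j 0 = ⌊<?⌋≡<ᵇ (suc j) 0
<r-shift Sign.+ j (+ suc a) rewrite shift-+ j (suc a) =
  trans (⌊<?⌋≡<ᵇ (suc j) (suc (bump j a))) (<ᵇ-bump j a)
<r-shift Sign.+ j -[1+ a ] rewrite shift-neg j a = refl
<r-shift Sign.- j (+ a) rewrite shift-+ j a = refl
<r-shift Sign.- j -[1+ a ] rewrite shift-neg j a =
  trans (⌊<?⌋≡<ᵇ j (bump j a)) (<ᵇ-bump j a)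

-- A shifted entry never has absolute value j + 1, so equality is excluded and being below is the
-- negation of being above.
shift-<r : ∀ s j x → (shift (suc j) x <r (s ◃ suc j)) ≡ not (above s j x)
shift-<r Sign.+ j (+ zero) rewrite shift-+ j 0 = ⌊<?⌋≡<ᵇ 0 (suc j)
shift-<r Sign.+ j (+ suc a) rewrite shift-+ j (suc a) =
  trans (⌊<?⌋≡<ᵇ (suc (bump j a)) (suc j)) (bump-<ᵇ-self j a)
shift-<r Sign.+ j -[1+ a ] rewrite shift-neg j a = refl
shift-<r Sign.- j (+ a) rewrite shift-+ j a = refl
shift-<r Sign.- j -[1+ a ] rewrite shift-neg j a =
  trans (⌊<?⌋≡<ᵇ (bump j a) j) (bump-<ᵇ-self j a)

<ᵇ-monoʳ : ∀ j {a b} → (a <ᵇ b) ≡ true → (j <ᵇ a) ≡ true → (j <ᵇ b) ≡ true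
<ᵇ-monoʳ zero    {suc a} {suc b} _ _ = refl
<ᵇ-monoʳ (suc j) {suc a} {suc b} p q = <ᵇ-monoʳ j {a} {b} p q

<ᵇ-monoʳ-≤ : ∀ j {a b} → (b <ᵇ a) ≡ false → (j <ᵇ a) ≡ true → (j <ᵇ b) ≡ true
<ᵇ-monoʳ-≤ zero    {suc a} {suc b} _ _ = refl
<ᵇ-monoʳ-≤ (suc j) {suc a} {suc b} p q = <ᵇ-monoʳ-≤ j {a} {b} p q

-- Entries above a threshold form an up-set of the r-order. This form serves a descent from `x` to
-- `y`, the next one a non-descent.
above-mono-< : ∀ s j x y → (y <r x) ≡ true → above s j y ≡ true → above s j x ≡ true
above-mono-< Sign.+ j (+ a) (+ b) p q = <ᵇ-monoʳ j {b} {a} (trans (sym (⌊<?⌋≡<ᵇ b a)) p) q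
above-mono-< Sign.- j (+ a) y p q = refl
above-mono-< Sign.- j -[1+ a ] -[1+ b ] p q =
  <ᵇ-monoʳ j {suc b} {suc a} (trans (sym (⌊<?⌋≡<ᵇ b a)) p) q

above-mono-≤ : ∀ s j x y → (y <r x) ≡ false → above s j x ≡ true → above s j y ≡ true
above-mono-≤ Sign.+ j (+ a) (+ b) p q = <ᵇ-monoʳ-≤ j {a} {b} (trans (sym (⌊<?⌋≡<ᵇ b a)) p) q
above-mono-≤ Sign.- j x (+ b) p q = refl
above-mono-≤ Sign.- j -[1+ a ] -[1+ b ] p q =
  <ᵇ-monoʳ-≤ j {suc a} {suc b} (trans (sym (⌊<?⌋≡<ᵇ b a)) p) q

<ᵇ-step : ∀ j a → (j <ᵇ a) ≡ (suc j <ᵇ a) ⊎ a ≡ suc j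
<ᵇ-step j       zero          = inj₁ refl
<ᵇ-step zero    (suc zero)    = inj₂ refl
<ᵇ-step zero    (suc (suc a)) = inj₁ refl
<ᵇ-step (suc j) (suc a) with <ᵇ-step j a
... | inj₁ eq = inj₁ eq
... | inj₂ eq = inj₂ (cong suc eq)

-- Raising the threshold by one affects the single value s(j + 1). Hence, in the summation by parts,
-- an entry contributes at one column at most.
above-step : ∀ s j x → above s j x ≡ above s (suc j) x ⊎ x ≡ s ◃ suc j
above-step Sign.+ j (+ a) with <ᵇ-step j a
... | inj₁ eq = inj₁ eq
... | inj₂ eq = inj₂ (cong +_ eq)
above-step Sign.+ j -[1+ a ] = inj₁ refl
above-step Sign.- j (+ a)    = inj₁ refl
above-step Sign.- j -[1+ a ] with <ᵇ-step j (suc a)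
... | inj₁ eq = inj₁ eq
... | inj₂ refl = inj₂ refl

n<ᵇ1+n : ∀ n → (n <ᵇ suc n) ≡ true
n<ᵇ1+n zero    = refl
n<ᵇ1+n (suc n) = n<ᵇ1+n n

n≮ᵇn : ∀ n → (n <ᵇ n) ≡ false
n≮ᵇn zero    = refl
n≮ᵇn (suc n) = n≮ᵇn n

n≡ᵇn : ∀ n → (n ≡ᵇ n) ≡ true
n≡ᵇn zero    = refl
n≡ᵇn (suc n) = n≡ᵇn n

-- Together with `above-pred` this supplies the factors 1 and 0 by which the double count keeps one
-- drop and discards the other.
above-self : ∀ s i → above s i (s ◃ suc i) ≡ true
above-self Sign.+ i = n<ᵇ1+n i
above-self Sign.- i = n<ᵇ1+n i

above-pred : ∀ s i → above s (suc i) (s ◃ suc i) ≡ false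
above-pred Sign.+ i = n≮ᵇn i
above-pred Sign.- i = n≮ᵇn i

-- Descents created by an insertion

entry : List ℤ → ℕ → Maybe ℤ
entry xs k = head (drop k xs)

-- The position after the last entry counts as an entry +∞.
level : Sign → ℕ → List ℤ → ℕ → ℤ
level s j xs k = maybe (λ x → ι (above s j x)) 1ℤ (entry xs k)

-- The default 0 at the last position fits the convention of a terminal +∞, into which there is no
-- descent.
descentAt : List ℤ → ℕ → ℤ
descentAt (x ∷ y ∷ r) zero    = ι (y <r x)
descentAt (x ∷ y ∷ r) (suc k) = descentAt (y ∷ r) k
descentAt _           _       = 0ℤ

slack : Sign → ℕ → List ℤ → ℕ → ℤ
slack s j xs k = descentAt xs k + (level s j xs (suc k) - level s j xs k)

IsBit : ℤ → Set
IsBit x = x ≡ 0ℤ ⊎ x ≡ 1ℤ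

-- Here d is the descent indicator of two neighbours and p, q are their levels. A descent forces q ≤
-- p and a non-descent p ≤ q, so q - p never takes d out of the range from 0 to 1.
bit-difference : ∀ d p q → (d ≡ true → q ≡ true → p ≡ true) →
                 (d ≡ false → p ≡ true → q ≡ true) → IsBit (ι d + (ι q - ι p))
bit-difference true  true  true  _ _ = inj₂ refl
bit-difference true  true  false _ _ = inj₁ refl
bit-difference true  false true  f _ with () ← f refl refl
bit-difference true  false false _ _ = inj₂ refl
bit-difference false true  true  _ _ = inj₁ refl
bit-difference false true  false _ f with () ← f refl refl
bit-difference false false true  _ _ = inj₂ refl
bit-difference false false false _ _ = inj₁ refl

slack-bit : ∀ s j x xs k → k ≤ length xs → IsBit (slack s j (x ∷ xs) k)
slack-bit s j x []      zero    _ with above s j x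
... | true  = inj₁ refl
... | false = inj₂ refl
slack-bit s j x (y ∷ r) zero    _ =
  bit-difference (y <r x) (above s j x) (above s j y) (above-mono-< s j x y) (above-mono-≤ s j x y)
slack-bit s j x (y ∷ r) (suc k) (s≤s k≤n) = slack-bit s j y r k k≤n

descents-shift : ∀ j xs → descents (map (shift (suc j)) xs) ≡ descents xs
descents-shift j []          = refl
descents-shift j (x ∷ [])    = refl
descents-shift j (x ∷ y ∷ r) =
  cong₂ (λ b m → (if b then 1 else 0) ℕ.+ m) (shift-mono j y x) (descents-shift j (y ∷ r))

ι-not : ∀ b → ι (not b) ≡ 1ℤ - ι b
ι-not true  = refl
ι-not false = refl

-- Inserting a value between x and y replaces the indicator d of that pair by p for the pair on the
-- left and 1 - q for the pair on the right; at the end of the list only the left pair appears. All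
-- other pairs keep their order under the shift.
descents-insertAt : ∀ s j x xs k → k ≤ length xs →
  + descents (shift (suc j) x ∷ insertAt (suc k) (s ◃ suc j) (map (shift (suc j)) xs)) ≡
  + descents (x ∷ xs) + (1ℤ - slack s j (x ∷ xs) k)
descents-insertAt s j x [] zero _ rewrite <r-shift s j x with above s j x
... | true  = refl
... | false = refl
descents-insertAt s j x (y ∷ r) zero _
  rewrite <r-shift s j x | shift-<r s j y | descents-shift j (y ∷ r) =
  trans (cong (λ z → ι (above s j x) + (z + + descents (y ∷ r))) (ι-not (above s j y)))
        (lemma (ι (above s j x)) (ι (above s j y)) (+ descents (y ∷ r)) (ι (y <r x)))
  where
  lemma : ∀ p q m d → p + ((1ℤ - q) + m) ≡ (d + m) + (1ℤ - (d + (q - p)))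
  lemma = solve-∀
descents-insertAt s j x (y ∷ r) (suc k) (s≤s k≤n)
  rewrite shift-mono j y x =
  trans (cong (_+_ (ι (y <r x))) (descents-insertAt s j y r k k≤n))
        (lemma (ι (y <r x)) (+ descents (y ∷ r)) (1ℤ - slack s j (y ∷ r) k))
  where
  lemma : ∀ a b c → a + (b + c) ≡ (a + b) + c
  lemma = solve-∀

insert : Sign → ℕ → ℕ → List ℤ → List ℤ
insert s i j π = insertAt (suc i) (s ◃ suc j) (map (shift (suc j)) π)

desB-insert : ∀ s i j π → i ≤ length π →
              + desB (insert s i j π) - + desB π ≡ 1ℤ - slack s j (+ 0 ∷ π) i
desB-insert s i j π i≤n =
  trans (cong (_- + desB π)
              -- The shift fixes 0, so the leading 0 of `desB` may be read as a shifted entry.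
              (trans (cong (λ z → + descents (z ∷ insert s i j π)) (sym (shift-+ j 0)))
                     (descents-insertAt s j (+ 0) π i i≤n)))
        (lemma (+ desB π) (1ℤ - slack s j (+ 0 ∷ π) i))
  where
  lemma : ∀ a b → (a + b) - a ≡ b
  lemma = solve-∀

-- The inverse of an insertion

sgnMul-shift : ∀ j x p → sgnMul (shift (suc j) x) p ≡ sgnMul x p
sgnMul-shift j (+ a)    p = cong (λ z → sgnMul z p) (shift-+ j a)
sgnMul-shift j -[1+ a ] p = cong (λ z → sgnMul z p) (shift-neg j a)

shift-sgnMul : ∀ t x p → shift (suc t) (sgnMul x (suc p)) ≡ sgnMul x (suc (bump t p))
shift-sgnMul t (+ _)    p = shift-+ t (suc p)
shift-sgnMul t -[1+ _ ] p = shift-neg t p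

∣◃∣ : ∀ s j → ∣ s ◃ suc j ∣ ≡ suc j
∣◃∣ Sign.+ j = refl
∣◃∣ Sign.- j = refl

sgnMul-◃ : ∀ s j p → sgnMul (s ◃ suc j) (suc p) ≡ s ◃ suc p
sgnMul-◃ Sign.+ j p = refl
sgnMul-◃ Sign.- j p = refl

shifted-key : ∀ j k x → ⌊ ∣ shift (suc j) x ∣ ≟ suc (bump j k) ⌋ ≡ ⌊ ∣ x ∣ ≟ suc k ⌋
shifted-key j k x rewrite ∣shift∣ j x =
  trans (⌊≟⌋≡≡ᵇ _ (suc (bump j k)))
        (trans (bump-≡ᵇ (suc j) ∣ x ∣ (suc k)) (sym (⌊≟⌋≡≡ᵇ ∣ x ∣ (suc k))))

-- Past the insertion every position grows by one, and t ≤ a places all of them where the outer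
-- shift does the same. A missing key yields 0, which the shift fixes.
findPos-after : ∀ j k t a → t ≤ a → ∀ xs →
  findPos (suc (suc a)) (suc (bump j k)) (map (shift (suc j)) xs) ≡
  shift (suc t) (findPos (suc a) (suc k) xs)
findPos-after j k t a t≤a [] = sym (shift-+ t 0)
findPos-after j k t a t≤a (x ∷ xs) rewrite shifted-key j k x with ⌊ ∣ x ∣ ≟ suc k ⌋
... | true  = trans (sgnMul-shift j x (suc (suc a)))
                    (trans (cong (sgnMul x ∘ suc) (sym (bump-≥ t≤a))) (sym (shift-sgnMul t x a)))
... | false = findPos-after j k t (suc a) (ℕ.m≤n⇒m≤1+n t≤a) xs

-- As `a` entries have been passed already, the new entry sits at position i + a, counted from 0.
-- Matches before it lie below the threshold of the outer shift and keep their position; the rest is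
-- `findPos-after`.
findPos-insert-bump : ∀ s j k i a xs → i ≤ length xs →
  findPos (suc a) (suc (bump j k)) (insert s i j xs) ≡
  shift (suc (i ℕ.+ a)) (findPos (suc a) (suc k) xs)
findPos-insert-bump s j k zero a xs _
  rewrite ∣◃∣ s j | ⌊≟⌋≡≡ᵇ (suc j) (suc (bump j k)) | ≢ᵇ-bump j k = findPos-after j k a a ℕ.≤-refl xs
findPos-insert-bump s j k (suc i) a (x ∷ xs) (s≤s i≤n)
  rewrite shifted-key j k x with ⌊ ∣ x ∣ ≟ suc k ⌋
... | true  = trans (sgnMul-shift j x (suc a))
                    (trans (cong (sgnMul x ∘ suc) (sym (bump-< (s≤s (ℕ.m≤n+m a i)))))
                           (sym (shift-sgnMul (suc i ℕ.+ a) x a)))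
... | false = trans (findPos-insert-bump s j k i (suc a) xs i≤n)
                    (cong (λ t → shift (suc t) (findPos (suc (suc a)) (suc k) xs)) (ℕ.+-suc i a))

-- No shifted entry has absolute value j + 1, so the search passes them all and stops at the new
-- entry.
findPos-insert-new : ∀ s j i a xs → i ≤ length xs →
  findPos (suc a) (suc j) (insert s i j xs) ≡ s ◃ suc (i ℕ.+ a)
findPos-insert-new s j zero a xs _
  rewrite ∣◃∣ s j | ⌊≟⌋≡≡ᵇ (suc j) (suc j) | n≡ᵇn j = sgnMul-◃ s j a
findPos-insert-new s j (suc i) a (x ∷ xs) (s≤s i≤n)
  rewrite ∣shift∣ j x | ⌊≟⌋≡≡ᵇ (bump (suc j) ∣ x ∣) (suc j) | bump-≢ᵇ (suc j) ∣ x ∣ =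
  trans (findPos-insert-new s j i (suc a) xs i≤n) (cong (λ t → s ◃ suc t) (ℕ.+-suc i a))

-- Every index is either j or in the image of `bump j`, which is increasing.
applyUpTo-insert : ∀ {A : Set} (F : ℕ → A) j n → j ≤ n →
  applyUpTo F (suc n) ≡
  take j (applyUpTo (F ∘ bump j) n) ++ F j ∷ drop j (applyUpTo (F ∘ bump j) n)
applyUpTo-insert F zero    n       _         = refl
applyUpTo-insert F (suc j) (suc n) (s≤s j≤n) = cong (F 0 ∷_) (applyUpTo-insert (F ∘ suc) j n j≤n)

invB-upTo : ∀ π → invB π ≡ map (λ k → findPos 1 (suc k) π) (upTo (length π))
invB-upTo π = sym (map-∘ (upTo (length π)))

length-invB : ∀ π → length (invB π) ≡ length π
length-invB π = trans (cong length (invB-upTo π)) (trans (length-map _ (upTo (length π))) (length-upTo _))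

length-insert : ∀ s i j π → i ≤ length π → length (insert s i j π) ≡ suc (length π)
length-insert s zero    j π       _         = cong suc (length-map _ π)
length-insert s (suc i) j (x ∷ π) (s≤s i≤n) = cong suc (length-insert s i j π i≤n)

-- Looking up the keys other than j + 1 returns the shifted old inverse, and the key j + 1 returns
-- s(i + 1). Inversion thus transposes the grid point and keeps the sign.
invB-insert : ∀ s i j π → i ≤ length π → j ≤ length π →
              invB (insert s i j π) ≡ insert s j i (invB π)
invB-insert s i j π i≤n j≤n = begin
  invB (insert s i j π)
    ≡⟨ invB-upTo (insert s i j π) ⟩
  map F (upTo (length (insert s i j π)))
    ≡⟨ cong (map F ∘ upTo) (length-insert s i j π i≤n) ⟩
  map F (upTo (suc n))
    ≡⟨ map-upTo F (suc n) ⟩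
  applyUpTo F (suc n)
    ≡⟨ applyUpTo-insert F j n j≤n ⟩
  take j (applyUpTo (F ∘ bump j) n) ++ F j ∷ drop j (applyUpTo (F ∘ bump j) n)
    ≡⟨ cong₂ (λ l v → take j l ++ v ∷ drop j l) shifted new ⟩
  insert s j i (invB π)
    ∎
  where
  open ≡-Reasoning
  n = length π
  F : ℕ → ℤ
  F k = findPos 1 (suc k) (insert s i j π)
  new : F j ≡ s ◃ suc i
  new = trans (findPos-insert-new s j i 0 π i≤n) (cong (λ t → s ◃ suc t) (ℕ.+-identityʳ i))
  shifted : applyUpTo (F ∘ bump j) n ≡ map (shift (suc i)) (invB π)
  shifted = begin
    applyUpTo (F ∘ bump j) n
      ≡⟨ map-upTo (F ∘ bump j) n ⟨
    map (F ∘ bump j) (upTo n)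
      ≡⟨ map-cong (λ k → trans (findPos-insert-bump s j k i 0 π i≤n)
                               (cong (λ t → shift (suc t) (findPos 1 (suc k) π)) (ℕ.+-identityʳ i)))
                  (upTo n) ⟩
    map (λ k → shift (suc i) (findPos 1 (suc k) π)) (upTo n)
      ≡⟨ map-∘ (upTo n) ⟩
    map (shift (suc i)) (map (λ k → findPos 1 (suc k) π) (upTo n))
      ≡⟨ cong (map (shift (suc i))) (invB-upTo π) ⟨
    map (shift (suc i)) (invB π)
      ∎

idesB-insert : ∀ s i j π → i ≤ length π → j ≤ length π →
               + idesB (insert s i j π) - + idesB π ≡ 1ℤ - slack s i (+ 0 ∷ invB π) j
idesB-insert s i j π i≤n j≤n =
  trans (cong (λ ρ → + desB ρ - + idesB π) (invB-insert s i j π i≤n j≤n))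
        (desB-insert s j i (invB π) (subst (j ≤_) (sym (length-invB π)) j≤n))

-- Double counting

entry-beyond : ∀ xs → entry xs (length xs) ≡ nothing
entry-beyond []       = refl
entry-beyond (x ∷ xs) = entry-beyond xs

level-beyond : ∀ s j xs → level s j xs (length xs) ≡ 1ℤ
level-beyond s j xs = cong (maybe (λ x → ι (above s j x)) 1ℤ) (entry-beyond xs)

-- The total increment of every column, which climbs from the level of 0 to the level 1 of +∞. The
-- entry 0 lies below every positive threshold and above every negative one.
start : Sign → ℤ
start Sign.+ = 1ℤ
start Sign.- = 0ℤ

ι-above-0 : ∀ s j → ι (above s j (+ 0)) ≡ 1ℤ - start s
ι-above-0 Sign.+ zero    = refl
ι-above-0 Sign.+ (suc j) = refl
ι-above-0 Sign.- j       = refl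

Σ<-descentAt : ∀ x xs → Σ< (suc (length xs)) (descentAt (x ∷ xs)) ≡ + descents (x ∷ xs)
Σ<-descentAt x []       = refl
Σ<-descentAt x (y ∷ ys) = cong (_+_ (ι (y <r x))) (Σ<-descentAt y ys)

rise : Sign → List ℤ → ℕ → ℕ → ℤ
rise s π i j = level s j (+ 0 ∷ π) (suc i) - level s j (+ 0 ∷ π) i

Σ<-rise : ∀ s j π → Σ< (suc (length π)) (λ i → rise s π i j) ≡ start s
Σ<-rise s j π =
  trans (Σ<-telescope (suc (length π)) (level s j (+ 0 ∷ π)))
        (trans (cong₂ _-_ (level-beyond s j π) (ι-above-0 s j)) (lemma (start s)))
  where
  lemma : ∀ k → 1ℤ - (1ℤ - k) ≡ k
  lemma = solve-∀

Σ<-slack : ∀ s j π → Σ< (suc (length π)) (slack s j (+ 0 ∷ π)) ≡ + desB π + start s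
Σ<-slack s j π =
  trans (Σ<-distrib-+ (suc (length π)) (descentAt (+ 0 ∷ π)) (λ i → rise s π i j))
        (cong₂ _+_ (Σ<-descentAt (+ 0) π) (Σ<-rise s j π))

signCount : Sign → List ℤ → ℤ
signCount Sign.+ π = + length π - + negCount π
signCount Sign.- π = + negCount π

InRange : ℕ → ℕ → Set
InRange n a = 0 < a × a ≤ n

≤⇒≮ᵇ : ∀ {a n} → a ≤ n → (n <ᵇ a) ≡ false
≤⇒≮ᵇ {n = zero}  z≤n       = refl
≤⇒≮ᵇ {n = suc n} z≤n       = refl
≤⇒≮ᵇ {n = suc n} (s≤s a≤n) = ≤⇒≮ᵇ a≤n

-- An entry of sign s is above threshold 0 but not above threshold n, so it contributes 1. An entry
-- of the other sign has equal levels at both, and so does the terminal +∞.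
Σ<-signCount : ∀ s n π → All (InRange n ∘ ∣_∣) π →
               Σ< (suc (length π)) (λ i → level s 0 π i - level s n π i) ≡ signCount s π
Σ<-signCount Sign.+ n [] _ = refl
Σ<-signCount Sign.- n [] _ = refl
Σ<-signCount Sign.+ n (+ suc a ∷ π) ((_ , a<n) ∷ r) rewrite ≤⇒≮ᵇ a<n =
  trans (cong (_+_ 1ℤ) (Σ<-signCount Sign.+ n π r)) (lemma (+ length π) (+ negCount π))
  where
  lemma : ∀ l m → 1ℤ + (l - m) ≡ (1ℤ + l) - (0ℤ + m)
  lemma = solve-∀
Σ<-signCount Sign.+ n (-[1+ a ] ∷ π) (_ ∷ r) =
  trans (cong (_+_ 0ℤ) (Σ<-signCount Sign.+ n π r)) (lemma (+ length π) (+ negCount π))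
  where
  lemma : ∀ l m → 0ℤ + (l - m) ≡ (1ℤ + l) - (1ℤ + m)
  lemma = solve-∀
Σ<-signCount Sign.- n (+ a ∷ π) (_ ∷ r) = cong (_+_ 0ℤ) (Σ<-signCount Sign.- n π r)
Σ<-signCount Sign.- n (-[1+ a ] ∷ π) ((_ , a<n) ∷ r) rewrite ≤⇒≮ᵇ a<n =
  cong (_+_ 1ℤ) (Σ<-signCount Sign.- n π r)

-- The list `ρ` stands for the inverse of `π`. The hypothesis `inverse` concerns entries of sign s,
-- the ones whose level changes with the threshold.
module DoubleCount (s : Sign) (π ρ : List ℤ) (∣ρ∣≡n : length ρ ≡ length π)
  (inverse : ∀ {i j} → j < length π → entry π i ≡ just (s ◃ suc j) → entry ρ j ≡ just (s ◃ suc i))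
  where

  open ≡-Reasoning

  private
    n = length π

  -- The drop vanishes unless `π` has s(j + 1) at i. Then `ρ` has s(i + 1) at j, which is above
  -- threshold i, so the factor is 1.
  level-drop-hit : ∀ i {j} → j < n →
    (level s j π i - level s (suc j) π i) * level s i ρ j ≡ level s j π i - level s (suc j) π i
  level-drop-hit i {j} j<n with entry π i in eq
  ... | nothing = *-zeroˡ (level s i ρ j)
  ... | just x with above-step s j x
  ...   | inj₁ same rewrite same = lemma (ι (above s (suc j) x)) (level s i ρ j)
    where
    lemma : ∀ a q → (a - a) * q ≡ a - a
    lemma = solve-∀
  ...   | inj₂ x≡ rewrite inverse {i} j<n (trans eq (cong just x≡)) | above-self s i =
    *-identityʳ (ι (above s j x) - ι (above s (suc j) x))

  -- The leading 0 displaces the index by one: a nonzero drop now puts s(i) at position j of `ρ`,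
  -- which is not above threshold i, so the factor is 0. For i = 0 the level of the entry 0 is the
  -- same at all thresholds.
  level-drop-miss : ∀ i {j} → j < n →
    (level s j (+ 0 ∷ π) i - level s (suc j) (+ 0 ∷ π) i) * level s i ρ j ≡ 0ℤ
  level-drop-miss zero {j} _ rewrite ι-above-0 s j | ι-above-0 s (suc j) =
    lemma (1ℤ - start s) (level s 0 ρ j)
    where
    lemma : ∀ a q → (a - a) * q ≡ 0ℤ
    lemma = solve-∀
  level-drop-miss (suc i) {j} j<n with entry π i in eq
  ... | nothing = *-zeroˡ (level s (suc i) ρ j)
  ... | just x with above-step s j x
  ...   | inj₁ same rewrite same = lemma (ι (above s (suc j) x)) (level s (suc i) ρ j)
    where
    lemma : ∀ a q → (a - a) * q ≡ 0ℤ
    lemma = solve-∀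
  ...   | inj₂ x≡ rewrite inverse {i} j<n (trans eq (cong just x≡)) | above-pred s i =
    *-zeroʳ (ι (above s j x) - ι (above s (suc j) x))

  -- Summation by parts over j leaves drops of two neighbouring entries. The later one survives
  -- unchanged, the earlier one is annihilated, and the survivors telescope in j.
  rise-by-parts : ∀ i → Σ< (suc n) (λ j → rise s π i j * rise s ρ j i) ≡
                  (rise s π i n - rise s π i 0 * (1ℤ - start s)) + (level s 0 π i - level s n π i)
  rise-by-parts i = begin
    Σ< (suc n) (λ j → rise s π i j * rise s ρ j i)
      ≡⟨ Σ<-by-parts n (rise s π i) (level s i (+ 0 ∷ ρ)) ⟩
    (rise s π i n * level s i ρ n - rise s π i 0 * level s i (+ 0 ∷ ρ) 0)
      + Σ< n (λ j → (rise s π i j - rise s π i (suc j)) * level s i ρ j)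
      -- The boundary factors come from the two ends of `+ 0 ∷ ρ`: level 1 at +∞ and level 1 -
      -- `start s` at 0.
      ≡⟨ cong₂ _+_ (cong₂ _-_ (trans (cong (rise s π i n *_) level-end) (*-identityʳ (rise s π i n)))
                              (cong (rise s π i 0 *_) (ι-above-0 s i)))
                   (trans (Σ<-cong n drop-term) (Σ<-telescope′ n (λ j → level s j π i))) ⟩
    (rise s π i n - rise s π i 0 * (1ℤ - start s)) + (level s 0 π i - level s n π i)
      ∎
    where
    level-end : level s i ρ n ≡ 1ℤ
    level-end = subst (λ m → level s i ρ m ≡ 1ℤ) ∣ρ∣≡n (level-beyond s i ρ)
    split : ∀ a b a′ b′ q → ((a - b) - (a′ - b′)) * q ≡ (a - a′) * q - (b - b′) * q
    split = solve-∀
    minus-zero : ∀ a → a - 0ℤ ≡ a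
    minus-zero = solve-∀
    drop-term : ∀ {j} → j < n → (rise s π i j - rise s π i (suc j)) * level s i ρ j ≡
                level s j π i - level s (suc j) π i
    drop-term {j} j<n =
      trans (split (level s j π i) (level s j (+ 0 ∷ π) i)
                   (level s (suc j) π i) (level s (suc j) (+ 0 ∷ π) i) (level s i ρ j))
            (trans (cong₂ _-_ (level-drop-hit i j<n) (level-drop-miss i j<n))
                   (minus-zero (level s j π i - level s (suc j) π i)))

  Σ<²-rise-rise : All (InRange n ∘ ∣_∣) π →
    Σ<² (suc n) (λ i j → rise s π i j * rise s ρ j i) ≡ start s * start s + signCount s π
  Σ<²-rise-rise range = begin
    Σ<² (suc n) (λ i j → rise s π i j * rise s ρ j i)
      ≡⟨ Σ<-cong (suc n) (λ {i} _ → rise-by-parts i) ⟩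
    Σ< (suc n) (λ i → (rise s π i n - rise s π i 0 * (1ℤ - k)) + (level s 0 π i - level s n π i))
      ≡⟨ Σ<-distrib-+ (suc n) (λ i → rise s π i n - rise s π i 0 * (1ℤ - k))
                              (λ i → level s 0 π i - level s n π i) ⟩
    Σ< (suc n) (λ i → rise s π i n - rise s π i 0 * (1ℤ - k))
      + Σ< (suc n) (λ i → level s 0 π i - level s n π i)
      ≡⟨ cong₂ _+_ (Σ<-distrib-- (suc n) (λ i → rise s π i n) (λ i → rise s π i 0 * (1ℤ - k)))
                   (Σ<-signCount s n π range) ⟩
    (Σ< (suc n) (λ i → rise s π i n) - Σ< (suc n) (λ i → rise s π i 0 * (1ℤ - k))) + signCount s π
      ≡⟨ cong (_+ signCount s π)
              (cong₂ _-_ (Σ<-rise s n π)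
                         (trans (Σ<-*ʳ (suc n) (1ℤ - k) (λ i → rise s π i 0))
                                (cong (_* (1ℤ - k)) (Σ<-rise s 0 π)))) ⟩
    (k - k * (1ℤ - k)) + signCount s π
      ≡⟨ lemma k (signCount s π) ⟩
    k * k + signCount s π
      ∎
    where
    k = start s
    lemma : ∀ k c → (k - k * (1ℤ - k)) + c ≡ k * k + c
    lemma = solve-∀

  Σ<²-slackˡ : Σ<² (suc n) (λ i j → slack s j (+ 0 ∷ π) i) ≡ + suc n * (+ desB π + start s)
  Σ<²-slackˡ = begin
    Σ<² (suc n) (λ i j → slack s j (+ 0 ∷ π) i)
      ≡⟨ Σ<²-comm (suc n) (λ i j → slack s j (+ 0 ∷ π) i) ⟩
    Σ<² (suc n) (λ j i → slack s j (+ 0 ∷ π) i)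
      ≡⟨ Σ<-cong (suc n) (λ {j} _ → Σ<-slack s j π) ⟩
    Σ< (suc n) (λ _ → + desB π + start s)
      ≡⟨ Σ<-const (suc n) (+ desB π + start s) ⟩
    + suc n * (+ desB π + start s)
      ∎

  Σ<-slackʳ : ∀ i → Σ< (suc n) (slack s i (+ 0 ∷ ρ)) ≡ + desB ρ + start s
  Σ<-slackʳ i = subst (λ m → Σ< (suc m) (slack s i (+ 0 ∷ ρ)) ≡ + desB ρ + start s) ∣ρ∣≡n (Σ<-slack s i ρ)

  Σ<²-slackʳ : Σ<² (suc n) (λ i j → slack s i (+ 0 ∷ ρ) j) ≡ + suc n * (+ desB ρ + start s)
  Σ<²-slackʳ = trans (Σ<-cong (suc n) (λ {i} _ → Σ<-slackʳ i)) (Σ<-const (suc n) (+ desB ρ + start s))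

  Σ<²-slack-slack : All (InRange n ∘ ∣_∣) π →
    Σ<² (suc n) (λ i j → slack s j (+ 0 ∷ π) i * slack s i (+ 0 ∷ ρ) j) ≡
    (+ desB π + start s) * (+ desB ρ + start s) + signCount s π
  Σ<²-slack-slack range = begin
    Σ<² (suc n) (λ i j → slack s j (+ 0 ∷ π) i * slack s i (+ 0 ∷ ρ) j)
      -- The product is expanded only in part, so that each piece has a known sum: a row sum of
      -- slacks, a column sum of rises, and the double sum of products of rises.
      ≡⟨ Σ<²-cong (suc n) (λ {i} {j} _ _ → expand (D i) (rise s π i j) (E j) (rise s ρ j i)) ⟩
    Σ<² (suc n) (λ i j → D i * slack s i (+ 0 ∷ ρ) j + (rise s π i j * E j + rise s π i j * rise s ρ j i))
      ≡⟨ trans (Σ<²-distrib-+ (suc n) (λ i j → D i * slack s i (+ 0 ∷ ρ) j)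
                                      (λ i j → rise s π i j * E j + rise s π i j * rise s ρ j i))
               (cong (_+_ (Σ<² (suc n) (λ i j → D i * slack s i (+ 0 ∷ ρ) j)))
                     (Σ<²-distrib-+ (suc n) (λ i j → rise s π i j * E j)
                                            (λ i j → rise s π i j * rise s ρ j i))) ⟩
    Σ<² (suc n) (λ i j → D i * slack s i (+ 0 ∷ ρ) j)
      + (Σ<² (suc n) (λ i j → rise s π i j * E j) + Σ<² (suc n) (λ i j → rise s π i j * rise s ρ j i))
      ≡⟨ cong₂ _+_ first (cong₂ _+_ second (Σ<²-rise-rise range)) ⟩
    d * (e + k) + (k * e + (k * k + signCount s π))
      ≡⟨ collect d e k (signCount s π) ⟩
    (d + k) * (e + k) + signCount s π
      ∎
    where
    d = + desB π
    e = + desB ρ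
    k = start s
    D = descentAt (+ 0 ∷ π)
    E = descentAt (+ 0 ∷ ρ)
    expand : ∀ D x E y → (D + x) * (E + y) ≡ D * (E + y) + (x * E + x * y)
    expand = solve-∀
    collect : ∀ d e k c → d * (e + k) + (k * e + (k * k + c)) ≡ (d + k) * (e + k) + c
    collect = solve-∀
    first : Σ<² (suc n) (λ i j → D i * slack s i (+ 0 ∷ ρ) j) ≡ d * (e + k)
    first = begin
      Σ<² (suc n) (λ i j → D i * slack s i (+ 0 ∷ ρ) j)
        ≡⟨ Σ<-cong (suc n) (λ {i} _ → trans (Σ<-*ˡ (suc n) (D i) (slack s i (+ 0 ∷ ρ)))
                                            (cong (D i *_) (Σ<-slackʳ i))) ⟩
      Σ< (suc n) (λ i → D i * (e + k))
        ≡⟨ Σ<-*ʳ (suc n) (e + k) D ⟩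
      Σ< (suc n) D * (e + k)
        ≡⟨ cong (_* (e + k)) (Σ<-descentAt (+ 0) π) ⟩
      d * (e + k)
        ∎
    second : Σ<² (suc n) (λ i j → rise s π i j * E j) ≡ k * e
    second = begin
      Σ<² (suc n) (λ i j → rise s π i j * E j)
        ≡⟨ Σ<²-comm (suc n) (λ i j → rise s π i j * E j) ⟩
      Σ<² (suc n) (λ j i → rise s π i j * E j)
        ≡⟨ Σ<-cong (suc n) (λ {j} _ → trans (Σ<-*ʳ (suc n) (E j) (λ i → rise s π i j))
                                            (cong (_* E j) (Σ<-rise s j π))) ⟩
      Σ< (suc n) (λ j → k * E j)
        ≡⟨ Σ<-*ˡ (suc n) k E ⟩
      k * Σ< (suc n) E
        ≡⟨ cong (k *_) (subst (λ m → Σ< (suc m) E ≡ e) ∣ρ∣≡n (Σ<-descentAt (+ 0) ρ)) ⟩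
      k * e
        ∎

-- Entries of a signed permutation and of its inverse

All-entry : ∀ {P : ℤ → Set} {xs i x} → All P xs → entry xs i ≡ just x → P x
All-entry {i = zero}  (p ∷ _)  refl = p
All-entry {i = suc i} (_ ∷ ps) eq   = All-entry {i = i} ps eq

-- `findPos` returns the first match; distinct absolute values exclude a match before position i.
findPos-entry : ∀ a i {x} xs → Unique (map ∣_∣ xs) → entry xs i ≡ just x →
                findPos (suc a) ∣ x ∣ xs ≡ sgnMul x (suc (i ℕ.+ a))
findPos-entry a zero    (x ∷ xs) _ refl rewrite ⌊≟⌋≡≡ᵇ ∣ x ∣ ∣ x ∣ | n≡ᵇn ∣ x ∣ = refl
findPos-entry a (suc i) {x} (y ∷ xs) (y∉xs ∷ u) eq with ∣ y ∣ ≟ ∣ x ∣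
... | yes ∣y∣≡∣x∣ = contradiction ∣y∣≡∣x∣ (All-entry {i = i} (All.map⁻ y∉xs) eq)
... | no _ =
  trans (findPos-entry (suc a) i xs u eq) (cong (sgnMul x ∘ suc) (ℕ.+-suc i a))

entry-applyUpTo : ∀ (f : ℕ → ℤ) {j n} → j < n → entry (applyUpTo f n) j ≡ just (f j)
entry-applyUpTo f {zero}  {suc n} _         = refl
entry-applyUpTo f {suc j} {suc n} (s≤s j<n) = entry-applyUpTo (f ∘ suc) j<n

entry-invB : ∀ π {j} → j < length π → entry (invB π) j ≡ just (findPos 1 (suc j) π)
entry-invB π {j} j<n =
  trans (cong (λ l → entry l j) (trans (invB-upTo π) (map-upTo _ (length π))))
        (entry-applyUpTo (λ k → findPos 1 (suc k) π) j<n)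

invB-inverse : ∀ s π → Unique (map ∣_∣ π) → ∀ {i j} → j < length π →
               entry π i ≡ just (s ◃ suc j) → entry (invB π) j ≡ just (s ◃ suc i)
invB-inverse s π u {i} {j} j<n eq = trans (entry-invB π j<n) (cong just (begin
  findPos 1 (suc j) π                ≡⟨ cong (λ k → findPos 1 k π) (∣◃∣ s j) ⟨
  findPos 1 ∣ s ◃ suc j ∣ π          ≡⟨ findPos-entry 0 i π u eq ⟩
  sgnMul (s ◃ suc j) (suc (i ℕ.+ 0)) ≡⟨ sgnMul-◃ s j (i ℕ.+ 0) ⟩
  s ◃ suc (i ℕ.+ 0)                  ≡⟨ cong (λ t → s ◃ suc t) (ℕ.+-identityʳ i) ⟩
  s ◃ suc i                          ∎))
  where open ≡-Reasoning

range1-unique : ∀ n → Unique (range1 n)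
range1-unique n = Unique.map⁺ ℕ.suc-injective (Unique.upTo⁺ n)

range1-InRange : ∀ n → All (InRange n) (range1 n)
range1-InRange n = All.map⁺ (All.applyUpTo⁺₁ (λ k → k) n (λ k<n → s≤s z≤n , k<n))

module _ {n π} (perm : IsSignedPerm n π) where

  signedPerm-length : length π ≡ n
  signedPerm-length =
    trans (sym (length-map ∣_∣ π))
          (trans (↭-length perm) (trans (length-map suc (upTo n)) (length-upTo n)))

  signedPerm-unique : Unique (map ∣_∣ π)
  signedPerm-unique = Unique-resp-↭ (setoid ℕ) (↭⇒↭ₛ (↭-sym perm)) (range1-unique n)

  signedPerm-range : All (InRange n ∘ ∣_∣) π
  signedPerm-range = All.map⁻ (All-resp-↭ (↭-sym perm) (range1-InRange n))

-- The counts

-- An insertion raises the two statistics by 1 - g and 1 - h, so type (0,0) means g = h = 1, and so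
-- on. On bits each indicator is a combination of 1, g, h and gh, whose sums are known.
typeIndicators : ∀ {g h} → IsBit g → IsBit h →
    (ι (sameType (1ℤ - g , 1ℤ - h) (0ℤ , 0ℤ)) ≡ g * h)
  × (ι (sameType (1ℤ - g , 1ℤ - h) (1ℤ , 0ℤ)) ≡ h - g * h)
  × (ι (sameType (1ℤ - g , 1ℤ - h) (0ℤ , 1ℤ)) ≡ g - g * h)
  × (ι (sameType (1ℤ - g , 1ℤ - h) (1ℤ , 1ℤ)) ≡ ((1ℤ - g) - h) + g * h)
typeIndicators (inj₁ refl) (inj₁ refl) = refl , refl , refl , refl
typeIndicators (inj₁ refl) (inj₂ refl) = refl , refl , refl , refl
typeIndicators (inj₂ refl) (inj₁ refl) = refl , refl , refl , refl
typeIndicators (inj₂ refl) (inj₂ refl) = refl , refl , refl , refl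

module Counts (s : Sign) (π : List ℤ) (perm : IsSignedPerm (length π) π) where

  open ≡-Reasoning

  private
    n = length π
    N = + n
    d = + desB π
    e = + idesB π
    k = start s
    c = signCount s π

    g h : ℕ → ℕ → ℤ
    g i j = slack s j (+ 0 ∷ π) i
    h i j = slack s i (+ 0 ∷ invB π) j

  open DoubleCount s π (invB π) (length-invB π) (invB-inverse s π (signedPerm-unique perm))

  count : ℤ × ℤ → ℤ
  count t = Σ<² (suc n) (λ i j → ι (sameType (dtype (insert s i j π) π) t))

  private
    indicators : ∀ {i j} → i < suc n → j < suc n → _
    indicators {i} {j} (s≤s i≤n) (s≤s j≤n) =
      typeIndicators (slack-bit s j (+ 0) π i i≤n)
                     (slack-bit s i (+ 0) (invB π) j (subst (j ≤_) (sym (length-invB π)) j≤n))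

    count-by : ∀ t {F : ℕ → ℕ → ℤ} →
      (∀ {i j} → i < suc n → j < suc n → ι (sameType (1ℤ - g i j , 1ℤ - h i j) t) ≡ F i j) →
      count t ≡ Σ<² (suc n) F
    count-by t eq = Σ<²-cong (suc n) (λ {i} {j} i<n j<n →
      trans (cong (λ p → ι (sameType p t))
                  (cong₂ _,_ (desB-insert s i j π (s≤s⁻¹ i<n))
                             (idesB-insert s i j π (s≤s⁻¹ i<n) (s≤s⁻¹ j<n))))
            (eq i<n j<n))

    Σgh : Σ<² (suc n) (λ i j → g i j * h i j) ≡ (d + k) * (e + k) + c
    Σgh = Σ<²-slack-slack (signedPerm-range perm)

  count-00 : count (0ℤ , 0ℤ) ≡ (d + k) * (e + k) + c
  count-00 = trans (count-by _ (λ i<n j<n → proj₁ (indicators i<n j<n))) Σgh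

  count-10 : count (1ℤ , 0ℤ) ≡ (1ℤ + N) * (e + k) - ((d + k) * (e + k) + c)
  count-10 = begin
    count (1ℤ , 0ℤ)
      ≡⟨ count-by _ (λ i<n j<n → proj₁ (proj₂ (indicators i<n j<n))) ⟩
    Σ<² (suc n) (λ i j → h i j - g i j * h i j)
      ≡⟨ Σ<²-distrib-- (suc n) h (λ i j → g i j * h i j) ⟩
    Σ<² (suc n) h - Σ<² (suc n) (λ i j → g i j * h i j)
      ≡⟨ cong₂ _-_ Σ<²-slackʳ Σgh ⟩
    (1ℤ + N) * (e + k) - ((d + k) * (e + k) + c)
      ∎

  count-01 : count (0ℤ , 1ℤ) ≡ (1ℤ + N) * (d + k) - ((d + k) * (e + k) + c)
  count-01 = begin
    count (0ℤ , 1ℤ)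
      ≡⟨ count-by _ (λ i<n j<n → proj₁ (proj₂ (proj₂ (indicators i<n j<n)))) ⟩
    Σ<² (suc n) (λ i j → g i j - g i j * h i j)
      ≡⟨ Σ<²-distrib-- (suc n) g (λ i j → g i j * h i j) ⟩
    Σ<² (suc n) g - Σ<² (suc n) (λ i j → g i j * h i j)
      ≡⟨ cong₂ _-_ Σ<²-slackˡ Σgh ⟩
    (1ℤ + N) * (d + k) - ((d + k) * (e + k) + c)
      ∎

  -- The right side keeps the shape in which the sums deliver it, with `+ suc n` computing to
  -- `1ℤ + N`; simplification is left to the ring solver.
  count-11 : count (1ℤ , 1ℤ) ≡
    (((1ℤ + N) * ((1ℤ + N) * 1ℤ) - (1ℤ + N) * (d + k)) - (1ℤ + N) * (e + k)) + ((d + k) * (e + k) + c)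
  count-11 = begin
    count (1ℤ , 1ℤ)
      ≡⟨ count-by _ (λ i<n j<n → proj₂ (proj₂ (proj₂ (indicators i<n j<n)))) ⟩
    Σ<² (suc n) (λ i j → ((1ℤ - g i j) - h i j) + g i j * h i j)
      ≡⟨ Σ<²-distrib-+ (suc n) (λ i j → (1ℤ - g i j) - h i j) (λ i j → g i j * h i j) ⟩
    Σ<² (suc n) (λ i j → (1ℤ - g i j) - h i j) + Σ<² (suc n) (λ i j → g i j * h i j)
      ≡⟨ cong₂ _+_ (trans (Σ<²-distrib-- (suc n) (λ i j → 1ℤ - g i j) h)
                          (cong₂ _-_ (trans (Σ<²-distrib-- (suc n) (λ _ _ → 1ℤ) g)
                                            (cong₂ _-_ Σ1 Σ<²-slackˡ))
                                     Σ<²-slackʳ))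
                   Σgh ⟩
    (((1ℤ + N) * ((1ℤ + N) * 1ℤ) - (1ℤ + N) * (d + k)) - (1ℤ + N) * (e + k)) + ((d + k) * (e + k) + c)
      ∎
    where
    Σ1 : Σ<² (suc n) (λ _ _ → 1ℤ) ≡ (1ℤ + N) * ((1ℤ + N) * 1ℤ)
    Σ1 = trans (Σ<-cong (suc n) (λ _ → Σ<-const (suc n) 1ℤ)) (Σ<-const (suc n) ((1ℤ + N) * 1ℤ))

theorem6p8 : (n : ℕ) (π : List ℤ) → IsSignedPerm n π →
    let d = + desB π
        e = + idesB π
        m = + negCount π
        N = + n
    in (+ countPlus n π (0ℤ , 0ℤ) ≡ (d + 1ℤ) * (e + 1ℤ) - m + N)
     × (+ countPlus n π (1ℤ , 0ℤ) ≡ (e + 1ℤ) * (N - d) + m - N)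
     × (+ countPlus n π (0ℤ , 1ℤ) ≡ (d + 1ℤ) * (N - e) + m - N)
     × (+ countPlus n π (1ℤ , 1ℤ) ≡ (N - d) * (N - e) - m + N)
     × (+ countMinus n π (0ℤ , 0ℤ) ≡ d * e + m)
     × (+ countMinus n π (1ℤ , 0ℤ) ≡ e * (N - d + 1ℤ) - m)
     × (+ countMinus n π (0ℤ , 1ℤ) ≡ d * (N - e + 1ℤ) - m)
     × (+ countMinus n π (1ℤ , 1ℤ) ≡ (N - d + 1ℤ) * (N - e + 1ℤ) + m)
theorem6p8 n π perm with signedPerm-length perm
-- Matching identifies `n` with the length of `π`, the size used throughout `Counts`.
... | refl =
    plus P.count-00 (p00 d e m N)
  , plus P.count-10 (p10 d e m N)
  , plus P.count-01 (p01 d e m N)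
  , plus P.count-11 (p11 d e m N)
  , minus M.count-00 (m00 d e m)
  , minus M.count-10 (m10 d e m N)
  , minus M.count-01 (m01 d e m N)
  , minus M.count-11 (m11 d e m N)
  where
  module P = Counts Sign.+ π perm
  module M = Counts Sign.- π perm
  d = + desB π
  e = + idesB π
  m = + negCount π
  N = + length π
  -- At the grid point (i + 1, j + 1), `φ` and `φbar` unfold to `insert` with sign + and sign -, so
  -- the double sum over the grid is `count` by computation.
  plus : ∀ {t x y} → P.count t ≡ x → x ≡ y → + countPlus n π t ≡ y
  plus p q = trans (countWhere-gridPoints _ n) (trans p q)
  minus : ∀ {t x y} → M.count t ≡ x → x ≡ y → + countMinus n π t ≡ y
  minus p q = trans (countWhere-gridPoints _ n) (trans p q)
  -- For sign + the values of `start` and `signCount` are 1 and N - m; in the identities for sign -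
  -- they are 0 and m.
  p00 : ∀ d e m N → (d + 1ℤ) * (e + 1ℤ) + (N - m) ≡ (d + 1ℤ) * (e + 1ℤ) - m + N
  p00 = solve-∀
  p10 : ∀ d e m N → (1ℤ + N) * (e + 1ℤ) - ((d + 1ℤ) * (e + 1ℤ) + (N - m)) ≡
                    (e + 1ℤ) * (N - d) + m - N
  p10 = solve-∀
  p01 : ∀ d e m N → (1ℤ + N) * (d + 1ℤ) - ((d + 1ℤ) * (e + 1ℤ) + (N - m)) ≡
                    (d + 1ℤ) * (N - e) + m - N
  p01 = solve-∀
  p11 : ∀ d e m N → (((1ℤ + N) * ((1ℤ + N) * 1ℤ) - (1ℤ + N) * (d + 1ℤ)) - (1ℤ + N) * (e + 1ℤ))
                      + ((d + 1ℤ) * (e + 1ℤ) + (N - m)) ≡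
                    (N - d) * (N - e) - m + N
  p11 = solve-∀
  m00 : ∀ d e m → (d + 0ℤ) * (e + 0ℤ) + m ≡ d * e + m
  m00 = solve-∀
  m10 : ∀ d e m N → (1ℤ + N) * (e + 0ℤ) - ((d + 0ℤ) * (e + 0ℤ) + m) ≡ e * (N - d + 1ℤ) - m
  m10 = solve-∀
  m01 : ∀ d e m N → (1ℤ + N) * (d + 0ℤ) - ((d + 0ℤ) * (e + 0ℤ) + m) ≡ d * (N - e + 1ℤ) - m
  m01 = solve-∀
  m11 : ∀ d e m N → (((1ℤ + N) * ((1ℤ + N) * 1ℤ) - (1ℤ + N) * (d + 0ℤ)) - (1ℤ + N) * (e + 0ℤ))
                      + ((d + 0ℤ) * (e + 0ℤ) + m) ≡
                    (N - d + 1ℤ) * (N - e + 1ℤ) + m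
  m11 = solve-∀
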